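{- Let $L$ be a finite loop of order $n$. There is an isomorphism of vector spaces over $\mathbb{F}_2$ \[\mathcal{C}^2_\delta(L)\cong \mathcal{Z}^2(L)\times \mathcal{C}^1(L).\] As a consequence, \[\dim_{\mathbb{F}_2}\left(\mathcal{C}^2_\delta(L)\right)=\dim_{\mathbb{F}_2}\left(\mathcal{Z}^2(L)\right)+n.\]
   Context: A loop is a set $L$ with a binary operation (written by juxtaposition, not necessarily associative) having an identity element $e$ and such that for all $a,b\in L$ the equations $ax=b$ and $ya=b$ have unique solutions $x,y\in L$. For $k\ge 1$, $\mathcal{C}^k(L)$ is the set of all functions $L^k\to\mathbb{Z}_2$ ($k$-cochains), an $\mathbb{F}_2$-vector space under pointwise addition. $\mathcal{Z}^2(L)$ is the set of $2$-cocycles, i.e. those $\psi\in\mathcal{C}^2(L)$ with $\psi(a,b)+\psi(ab,c)=\psi(a,bc)+\psi(b,c)$ for all $a,b,c\in L$. A pair $(\psi,\phi)\in\mathcal{C}^2(L)\times\mathcal{C}^2(L)$ is $\delta$-compatible over $L$ if $\psi(a,b)+\phi(ab,c)=\phi(a,bc)+\psi(b,c)$ for all $a,b,c\in L$; $\mathcal{C}^2_\delta(L)$ denotes the set of all $\delta$-compatible pairs, with vector space structure inherited from $\mathcal{C}^2(L)\times\mathcal{C}^2(L)$. -}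

module Defs where

open import Algebra.Bundles using (CommutativeRing; Loop)
open import Algebra.Module.Bundles using (Module; RawModule)
open import Algebra.Module.Structures.Biased using (IsModuleFromLeft)
open import Algebra.Module.Morphism.Structures using (IsModuleMonomorphism; IsModuleIsomorphism)
import Algebra.Module.Morphism.ModuleMonomorphism as ModuleMonomorphism
import Algebra.Module.Construct.DirectProduct as DirectProduct
import Algebra.Definitions.RawMonoid as RawMonoid
import Algebra.Properties.CommutativeSemigroup as CommutativeSemigroupProperties
open import Data.Bool.Base using (Bool)
open import Data.Bool.Properties using (xor-∧-commutativeRing)
open import Data.Fin.Base using (Fin)
open import Data.Nat.Base using (ℕ)
open import Data.Product.Base using (Σ; ∃; _×_; _,_; proj₁; proj₂)
open import Data.Vec.Base using ([]; _∷_)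
import Data.Vec.Relation.Binary.Pointwise.Inductive as Pointwise
open import Function.Base using (id; flip)
open import Function.Bundles using (Func; _⟨$⟩_; Inverse)
open import Level using (Level; 0ℓ; _⊔_)
open import Relation.Binary.Bundles using (Setoid)
open import Relation.Binary.PropositionalEquality using (_≡_)
import Relation.Binary.PropositionalEquality as ≡
open import Relation.Unary using (Pred)

private
  variable
    c ℓ r ℓr m ℓm m′ ℓm′ p : Level

module _ {R : CommutativeRing r ℓr} where
  open CommutativeRing R using () renaming (Carrier to K; _≈_ to _≈ᴷ_; 0# to 0ᴷ)

  infix 4 _≅_
  _≅_ : Module R m ℓm → Module R m′ ℓm′ → Set _
  M ≅ N = ∃ (IsModuleIsomorphism (Module.rawModule M) (Module.rawModule N))

  record IsSubmodule (M : Module R m ℓm) (P : Pred (Module.Carrierᴹ M) p)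
                     : Set (r ⊔ m ⊔ p) where
    open Module M
    field
      zero-closed  : P 0ᴹ
      add-closed   : ∀ {x y} → P x → P y → P (x +ᴹ y)
      neg-closed   : ∀ {x} → P x → P (-ᴹ x)
      scale-closed : ∀ k {x} → P x → P (k *ₗ x)

  submodule : (M : Module R m ℓm) {P : Pred (Module.Carrierᴹ M) p} →
              IsSubmodule M P → Module R (m ⊔ p) ℓm
  submodule M {P} sub = record
    { isModule = ModuleMonomorphism.isModule inclusion
        (CommutativeRing.isCommutativeRing R) isModule }
    where
    open Module M
    open IsSubmodule sub

    raw : RawModule K _ _
    raw = record
      { Carrierᴹ = Σ Carrierᴹ P
      ; _≈ᴹ_     = λ x y → proj₁ x ≈ᴹ proj₁ y
      ; _+ᴹ_     = λ (x , px) (y , py) → x +ᴹ y , add-closed px py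
      ; _*ₗ_     = λ k (x , px) → k *ₗ x , scale-closed k px
      ; _*ᵣ_     = λ (x , px) k → k *ₗ x , scale-closed k px
      ; 0ᴹ       = 0ᴹ , zero-closed
      ; -ᴹ_      = λ (x , px) → -ᴹ x , neg-closed px
      }

    inclusion : IsModuleMonomorphism raw rawModule proj₁
    inclusion = record
      { isModuleHomomorphism = record
        { isBimoduleHomomorphism = record
          { +ᴹ-isGroupHomomorphism = record
            { isMonoidHomomorphism = record
              { isMagmaHomomorphism = record
                { isRelHomomorphism = record { cong = id }
                ; homo = λ _ _ → ≈ᴹ-refl
                }
              ; ε-homo = ≈ᴹ-refl
              }
            ; ⁻¹-homo = λ _ → ≈ᴹ-refl
            }
          ; *ₗ-homo = λ _ _ → ≈ᴹ-refl
          ; *ᵣ-homo = λ k x → *ₗ-*ᵣ-coincident k (proj₁ x)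
          }
        }
      ; injective = id
      }

  functionModule : Setoid c ℓ → Module R (c ⊔ ℓ ⊔ r ⊔ ℓr) (c ⊔ ℓr)
  functionModule S = record
    { Carrierᴹ = Func S setoid
    ; _≈ᴹ_     = λ f g → ∀ x → f ⟨$⟩ x ≈ g ⟨$⟩ x
    ; _+ᴹ_     = λ f g → record
      { to   = λ x → (f ⟨$⟩ x) + (g ⟨$⟩ x)
      ; cong = λ x≈y → +-cong (Func.cong f x≈y) (Func.cong g x≈y) }
    ; _*ₗ_     = scale
    ; _*ᵣ_     = flip scale
    ; 0ᴹ       = record { to = λ _ → 0# ; cong = λ _ → refl }
    ; -ᴹ_      = λ f → record
      { to   = λ x → - (f ⟨$⟩ x)
      ; cong = λ x≈y → -‿cong (Func.cong f x≈y) }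
    ; isModule = IsModuleFromLeft.isModule {commutativeRing = R} record
      { isLeftModule = record
        { isLeftSemimodule = record
          { +ᴹ-isCommutativeMonoid = record
            { isMonoid = record
              { isSemigroup = record
                { isMagma = record
                  { isEquivalence = record
                    { refl  = λ _ → refl
                    ; sym   = λ f≈g x → sym (f≈g x)
                    ; trans = λ f≈g g≈h x → trans (f≈g x) (g≈h x)
                    }
                  ; ∙-cong = λ f≈f′ g≈g′ x → +-cong (f≈f′ x) (g≈g′ x)
                  }
                ; assoc = λ f g h x → +-assoc (f ⟨$⟩ x) (g ⟨$⟩ x) (h ⟨$⟩ x)
                }
              ; identity = (λ f x → +-identityˡ (f ⟨$⟩ x)) , (λ f x → +-identityʳ (f ⟨$⟩ x))
              }
            ; comm = λ f g x → +-comm (f ⟨$⟩ x) (g ⟨$⟩ x)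
            }
          ; isPreleftSemimodule = record
            { *ₗ-cong      = λ k≈k′ f≈f′ x → *-cong k≈k′ (f≈f′ x)
            ; *ₗ-zeroˡ     = λ f x → zeroˡ (f ⟨$⟩ x)
            ; *ₗ-distribʳ  = λ f k k′ x → distribʳ (f ⟨$⟩ x) k k′
            ; *ₗ-identityˡ = λ f x → *-identityˡ (f ⟨$⟩ x)
            ; *ₗ-assoc     = λ k k′ f x → *-assoc k k′ (f ⟨$⟩ x)
            ; *ₗ-zeroʳ     = λ k x → zeroʳ k
            ; *ₗ-distribˡ  = λ k f g x → distribˡ k (f ⟨$⟩ x) (g ⟨$⟩ x)
            }
          }
        ; -ᴹ‿cong    = λ f≈g x → -‿cong (f≈g x)
        ; -ᴹ‿inverse = (λ f x → -‿inverseˡ (f ⟨$⟩ x)) , (λ f x → -‿inverseʳ (f ⟨$⟩ x))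
        }
      }
    }
    where
    open CommutativeRing R
    scale : K → Func S setoid → Func S setoid
    scale k f = record
      { to   = λ x → k * (f ⟨$⟩ x)
      ; cong = λ x≈y → *-cong refl (Func.cong f x≈y) }

  module _ (M : Module R m ℓm) where
    open Module M
    open RawMonoid +ᴹ-rawMonoid using (sum)

    linearCombination : ∀ {d} → (Fin d → K) → (Fin d → Carrierᴹ) → Carrierᴹ
    linearCombination k v = sum (λ i → k i *ₗ v i)

    LinearlyIndependent : ∀ {d} → (Fin d → Carrierᴹ) → Set _
    LinearlyIndependent v =
      ∀ k → linearCombination k v ≈ᴹ 0ᴹ → ∀ i → k i ≈ᴷ 0ᴷ

    Spanning : ∀ {d} → (Fin d → Carrierᴹ) → Set _
    Spanning v = ∀ x → ∃ λ k → x ≈ᴹ linearCombination k v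

    IsBasis : ∀ {d} → (Fin d → Carrierᴹ) → Set _
    IsBasis v = LinearlyIndependent v × Spanning v

    HasDimension : ℕ → Set _
    HasDimension d = ∃ λ (v : Fin d → Carrierᴹ) → IsBasis v

    FiniteDimensional : Set _
    FiniteDimensional = ∃ HasDimension

infixr 5 _×ᴹ_
_×ᴹ_ : {R : CommutativeRing r ℓr} → Module R m ℓm → Module R m′ ℓm′ →
       Module R (m ⊔ m′) (ℓm ⊔ ℓm′)
_×ᴹ_ = DirectProduct.⟨module⟩

-- The field with two elements, with xor as addition and ∧ as multiplication;
-- a vector space over it is a Module 𝔽₂.
𝔽₂ : CommutativeRing 0ℓ 0ℓ
𝔽₂ = xor-∧-commutativeRing

HasOrder : Loop c ℓ → ℕ → Set _
HasOrder L n = Inverse (Loop.setoid L) (≡.setoid (Fin n))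

module _ (L : Loop c ℓ) where
  private
    module L = Loop L
    module 𝔽 = CommutativeRing 𝔽₂
  open L using (_∙_) renaming (Carrier to |L|)
  open 𝔽 using (_+_; _*_)
  open CommutativeSemigroupProperties 𝔽.+-commutativeSemigroup using (interchange)

  -- All functions Lᵏ → ℤ₂. Since L carries a setoid equality, these are the
  -- functions respecting it, compared pointwise.
  𝒞 : (k : ℕ) → Module 𝔽₂ (c ⊔ ℓ) c
  𝒞 k = functionModule (Pointwise.setoid L.setoid k)

  Cochain : ℕ → Set _
  Cochain k = Module.Carrierᴹ (𝒞 k)

  infix 8 _⟨_,_⟩
  _⟨_,_⟩ : Cochain 2 → |L| → |L| → Bool
  ψ ⟨ a , b ⟩ = ψ ⟨$⟩ (a ∷ b ∷ [])

  IsCocycle : Cochain 2 → Set _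
  IsCocycle ψ = ∀ a b c →
    ψ ⟨ a , b ⟩ + ψ ⟨ a ∙ b , c ⟩ ≡ ψ ⟨ a , b ∙ c ⟩ + ψ ⟨ b , c ⟩

  IsCompatible : Cochain 2 × Cochain 2 → Set _
  IsCompatible (ψ , φ) = ∀ a b c →
    ψ ⟨ a , b ⟩ + φ ⟨ a ∙ b , c ⟩ ≡ φ ⟨ a , b ∙ c ⟩ + ψ ⟨ b , c ⟩

  compatible-isSubmodule : IsSubmodule (𝒞 2 ×ᴹ 𝒞 2) IsCompatible
  compatible-isSubmodule = record
    { zero-closed  = λ _ _ _ → ≡.refl
    ; add-closed   = λ {(ψ , φ)} {(ψ′ , φ′)} p q a b c → begin
        (ψ ⟨ a , b ⟩ + ψ′ ⟨ a , b ⟩) + (φ ⟨ a ∙ b , c ⟩ + φ′ ⟨ a ∙ b , c ⟩)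
          ≡⟨ interchange (ψ ⟨ a , b ⟩) (ψ′ ⟨ a , b ⟩) (φ ⟨ a ∙ b , c ⟩) (φ′ ⟨ a ∙ b , c ⟩) ⟩
        (ψ ⟨ a , b ⟩ + φ ⟨ a ∙ b , c ⟩) + (ψ′ ⟨ a , b ⟩ + φ′ ⟨ a ∙ b , c ⟩)
          ≡⟨ ≡.cong₂ _+_ (p a b c) (q a b c) ⟩
        (φ ⟨ a , b ∙ c ⟩ + ψ ⟨ b , c ⟩) + (φ′ ⟨ a , b ∙ c ⟩ + ψ′ ⟨ b , c ⟩)
          ≡⟨ interchange (φ ⟨ a , b ∙ c ⟩) (ψ ⟨ b , c ⟩) (φ′ ⟨ a , b ∙ c ⟩) (ψ′ ⟨ b , c ⟩) ⟩
        (φ ⟨ a , b ∙ c ⟩ + φ′ ⟨ a , b ∙ c ⟩) + (ψ ⟨ b , c ⟩ + ψ′ ⟨ b , c ⟩) ∎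
    ; neg-closed   = id
    ; scale-closed = λ k {(ψ , φ)} p a b c → begin
        k * ψ ⟨ a , b ⟩ + k * φ ⟨ a ∙ b , c ⟩
          ≡⟨ 𝔽.distribˡ k (ψ ⟨ a , b ⟩) (φ ⟨ a ∙ b , c ⟩) ⟨
        k * (ψ ⟨ a , b ⟩ + φ ⟨ a ∙ b , c ⟩)
          ≡⟨ ≡.cong (k *_) (p a b c) ⟩
        k * (φ ⟨ a , b ∙ c ⟩ + ψ ⟨ b , c ⟩)
          ≡⟨ 𝔽.distribˡ k (φ ⟨ a , b ∙ c ⟩) (ψ ⟨ b , c ⟩) ⟩
        k * φ ⟨ a , b ∙ c ⟩ + k * ψ ⟨ b , c ⟩ ∎
    }
    where open ≡.≡-Reasoning

  -- IsCocycle ψ is definitionally IsCompatible (ψ , ψ).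
  cocycles-isSubmodule : IsSubmodule (𝒞 2) IsCocycle
  cocycles-isSubmodule = record
    { zero-closed  = Compatible.zero-closed
    ; add-closed   = λ {ψ} {ψ′} → Compatible.add-closed {ψ , ψ} {ψ′ , ψ′}
    ; neg-closed   = λ {ψ} → Compatible.neg-closed {ψ , ψ}
    ; scale-closed = λ k {ψ} → Compatible.scale-closed k {ψ , ψ}
    }
    where module Compatible = IsSubmodule compatible-isSubmodule

  𝒵² : Module 𝔽₂ (c ⊔ ℓ) c
  𝒵² = submodule (𝒞 2) cocycles-isSubmodule

  𝒞²δ : Module 𝔽₂ (c ⊔ ℓ) c
  𝒞²δ = submodule (𝒞 2 ×ᴹ 𝒞 2) compatible-isSubmodule

{-# OPTIONS --safe #-}
-- Putting b = e in the compatibility equation shows that ψ(e,-) = ψ(-,e) is constant; putting a = e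
-- then gives φ(a,b) = ψ(a,b) + f(ab), where f = φ(e,-) + ψ(e,-).  For the coboundary
-- δf(a,b) = f(ab) + f(a) + f(b), the cocycle defect of δf at (a,b,c) is f((ab)c) + f(a(bc)), also when
-- the loop is not associative, and this is exactly the cocycle defect of ψ.  Hence
-- (ψ,φ) ↦ (ψ + δf , f) is the isomorphism, with inverse (ζ,f) ↦ (ζ + δf , ζ + δf + f∘∙).
-- The dimension count is linear algebra over 𝔽₂, where a subspace given by a decidable predicate is
-- spanned by its finitely many elements and bases can be found, and compared, by counting coefficients.
module Submission where

open import Defs
open import Algebra.Bundles using (CommutativeMonoid; CommutativeRing; Loop)
open import Algebra.Module.Bundles using (Module)
import Algebra.Module.Construct.TensorUnit as TensorUnit
open import Algebra.Module.Morphism.Structures using (IsModuleHomomorphism; IsModuleIsomorphism)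
import Algebra.Properties.CommutativeMonoid.Sum as Sum
open import Data.Bool.Base using (Bool; true; false; _∧_; _xor_)
import Data.Bool.Properties as Bool
open import Data.Bool.Solver using (module xor-∧-Solver)
open import Data.Empty using (⊥-elim)
open import Data.Fin.Base using (Fin; zero; suc; _↑ˡ_; _↑ʳ_; splitAt; join; punchIn;
                                combine; remQuot; finToFun; funToFin)
import Data.Fin.Properties as Fin
open import Data.Nat.Base using (ℕ; zero; suc; _+_; _^_; _≤_)
import Data.Nat.Properties as ℕ
open import Data.Product.Base using (_×_; _,_; proj₁; proj₂)
open import Data.Sum.Base using (inj₁; inj₂)
open import Data.Vec.Base using (Vec; []; _∷_)
open import Data.Vec.Functional using (removeAt; _++_)
import Data.Vec.Functional.Properties as Vector
import Data.Vec.Relation.Binary.Pointwise.Inductive as Pointwise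
open import Data.Vec.Relation.Binary.Pointwise.Inductive using ([]; _∷_)
open import Function.Base using (_∘_)
open import Function.Bundles using (Inverse; _⟨$⟩_; Func)
open import Level using (Level)
open import Relation.Binary.Bundles using (Setoid)
open import Relation.Binary.Definitions using (_Respects_)
open import Relation.Binary.PropositionalEquality using (_≡_; _≢_; _≗_)
import Relation.Binary.PropositionalEquality as ≡
import Relation.Binary.Reasoning.Setoid as ≈-Reasoning
open import Relation.Nullary using (Dec; yes; no)
open import Relation.Nullary.Decidable using (map′; _×-dec_)
open import Relation.Unary using (Pred; Decidable)

private
  variable
    a c ℓ r ℓr m ℓm m′ ℓm′ p : Level
    d e n : ℕ

-- Finite sums and linear combinations.

module _ (M : CommutativeMonoid a ℓ) where
  open CommutativeMonoid M
  open Sum M using (sum; sum-remove; sum-cong-≋; sum-replicate-zero)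

  sum-single : ∀ (i : Fin d) (t : Fin d → Carrier) →
               (∀ j → j ≢ i → t j ≈ ε) → sum t ≈ t i
  sum-single {suc d} i t t≈ε = begin
    sum t                        ≈⟨ sum-remove t ⟩
    t i ∙ sum (removeAt t i)     ≈⟨ ∙-congˡ (sum-cong-≋ (λ j → t≈ε (punchIn i j) (Fin.punchInᵢ≢i i j))) ⟩
    t i ∙ sum {d} (λ _ → ε)      ≈⟨ ∙-congˡ (sum-replicate-zero d) ⟩
    t i ∙ ε                      ≈⟨ identityʳ (t i) ⟩
    t i                          ∎
    where open ≈-Reasoning setoid

module _ {R : CommutativeRing r ℓr} where
  private
    module R = CommutativeRing R
  open R using () renaming (Carrier to K)

  indicator : Fin d → Fin d → K
  indicator i j with j Fin.≟ i
  ... | yes _ = R.1#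
  ... | no  _ = R.0#

  indicator-≡ : (i : Fin d) → indicator i i ≡ R.1#
  indicator-≡ i with i Fin.≟ i
  ... | yes _   = ≡.refl
  ... | no  i≢i = ⊥-elim (i≢i ≡.refl)

  indicator-≢ : {i j : Fin d} → j ≢ i → indicator i j ≡ R.0#
  indicator-≢ {i = i} {j} j≢i with j Fin.≟ i
  ... | yes j≡i = ⊥-elim (j≢i j≡i)
  ... | no  _   = ≡.refl

  module _ (M : Module R m ℓm) where
    open Module M
    open Sum +ᴹ-commutativeMonoid using (sum-cong-≋; sum-replicate-zero; ∑-distrib-+; sum-remove)
    open ≈-Reasoning ≈ᴹ-setoid

    linearCombination-cong : {k k′ : Fin d → K} {v v′ : Fin d → Carrierᴹ} →
      (∀ i → k i R.≈ k′ i) → (∀ i → v i ≈ᴹ v′ i) →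
      linearCombination M k v ≈ᴹ linearCombination M k′ v′
    linearCombination-cong k≈k′ v≈v′ = sum-cong-≋ (λ i → *ₗ-cong (k≈k′ i) (v≈v′ i))

    linearCombination-congˡ : {k k′ : Fin d → K} (v : Fin d → Carrierᴹ) →
      (∀ i → k i R.≈ k′ i) → linearCombination M k v ≈ᴹ linearCombination M k′ v
    linearCombination-congˡ v k≈k′ = linearCombination-cong {v = v} {v} k≈k′ (λ _ → ≈ᴹ-refl)

    linearCombination-zero : {k : Fin d → K} (v : Fin d → Carrierᴹ) →
      (∀ i → k i R.≈ R.0#) → linearCombination M k v ≈ᴹ 0ᴹ
    linearCombination-zero {d} {k} v k≈0 = begin
      linearCombination M k v     ≈⟨ sum-cong-≋ (λ i → ≈ᴹ-trans (*ₗ-cong (k≈0 i) ≈ᴹ-refl) (*ₗ-zeroˡ (v i))) ⟩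
      Sum.sum +ᴹ-commutativeMonoid {d} (λ _ → 0ᴹ)  ≈⟨ sum-replicate-zero d ⟩
      0ᴹ                          ∎

    linearCombination-+ : (k k′ : Fin d → K) (v : Fin d → Carrierᴹ) →
      linearCombination M (λ i → k i R.+ k′ i) v ≈ᴹ linearCombination M k v +ᴹ linearCombination M k′ v
    linearCombination-+ k k′ v = begin
      linearCombination M (λ i → k i R.+ k′ i) v
        ≈⟨ sum-cong-≋ (λ i → *ₗ-distribʳ (v i) (k i) (k′ i)) ⟩
      Sum.sum +ᴹ-commutativeMonoid (λ i → k i *ₗ v i +ᴹ k′ i *ₗ v i)
        ≈⟨ ∑-distrib-+ (λ i → k i *ₗ v i) (λ i → k′ i *ₗ v i) ⟩
      linearCombination M k v +ᴹ linearCombination M k′ v ∎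

    linearCombination-* : (x : K) (k : Fin d → K) (v : Fin d → Carrierᴹ) →
      linearCombination M (λ i → x R.* k i) v ≈ᴹ x *ₗ linearCombination M k v
    linearCombination-* {zero}  x k v = ≈ᴹ-sym (*ₗ-zeroʳ x)
    linearCombination-* {suc d} x k v = ≈ᴹ-trans
      (+ᴹ-cong (*ₗ-assoc x (k zero) (v zero)) (linearCombination-* x (k ∘ suc) (v ∘ suc)))
      (≈ᴹ-sym (*ₗ-distribˡ x _ _))

    linearCombination-++ : (k : Fin (d + e) → K) (v : Fin d → Carrierᴹ) (w : Fin e → Carrierᴹ) →
      linearCombination M k (v ++ w) ≈ᴹ
      linearCombination M (k ∘ (_↑ˡ e)) v +ᴹ linearCombination M (k ∘ (d ↑ʳ_)) w
    linearCombination-++ {zero}  k v w = ≈ᴹ-sym (+ᴹ-identityˡ _)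
    linearCombination-++ {suc d} {e} k v w = begin
      k zero *ₗ v zero +ᴹ linearCombination M (k ∘ suc) ((v ++ w) ∘ suc)
        ≈⟨ +ᴹ-congˡ (linearCombination-cong (λ _ → R.refl) tail-++) ⟩
      k zero *ₗ v zero +ᴹ linearCombination M (k ∘ suc) ((v ∘ suc) ++ w)
        ≈⟨ +ᴹ-congˡ (linearCombination-++ (k ∘ suc) (v ∘ suc) w) ⟩
      k zero *ₗ v zero +ᴹ (linearCombination M (k ∘ suc ∘ (_↑ˡ e)) (v ∘ suc) +ᴹ linearCombination M (k ∘ (suc d ↑ʳ_)) w)
        ≈⟨ +ᴹ-assoc _ _ _ ⟨
      linearCombination M (k ∘ (_↑ˡ e)) v +ᴹ linearCombination M (k ∘ (suc d ↑ʳ_)) w ∎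
      where
      -- `splitAt (suc d) (suc i)` is stuck until `splitAt d i` is known, so the two families agree
      -- only after a case split.
      tail-++ : ∀ i → (v ++ w) (suc i) ≈ᴹ ((v ∘ suc) ++ w) i
      tail-++ i with splitAt d i
      ... | inj₁ _ = ≈ᴹ-refl
      ... | inj₂ _ = ≈ᴹ-refl

    linearCombination-indicator : (i : Fin d) (v : Fin d → Carrierᴹ) →
      linearCombination M (indicator i) v ≈ᴹ v i
    linearCombination-indicator i v = begin
      linearCombination M (indicator i) v
        ≈⟨ sum-single +ᴹ-commutativeMonoid i (λ j → indicator i j *ₗ v j)
             (λ j j≢i → ≈ᴹ-trans (*ₗ-cong (R.reflexive (indicator-≢ j≢i)) ≈ᴹ-refl) (*ₗ-zeroˡ (v j))) ⟩
      indicator i i *ₗ v i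
        ≈⟨ *ₗ-cong (R.reflexive (indicator-≡ i)) ≈ᴹ-refl ⟩
      R.1# *ₗ v i
        ≈⟨ *ₗ-identityˡ (v i) ⟩
      v i ∎

  -- Linear maps, and dimensions of isomorphic modules, products and function modules.

  module _ (M : Module R m ℓm) (N : Module R m′ ℓm′) where
    private
      module M = Module M
      module N = Module N

    -- Linearity is passed as three separate laws, so that the inclusions into a product and
    -- evaluation at a point can serve as `f` without a homomorphism record.
    linearCombination-homo : (f : M.Carrierᴹ → N.Carrierᴹ) →
      f M.0ᴹ N.≈ᴹ N.0ᴹ →
      (∀ x y → f (x M.+ᴹ y) N.≈ᴹ f x N.+ᴹ f y) →
      (∀ k x → f (k M.*ₗ x) N.≈ᴹ k N.*ₗ f x) →
      (k : Fin d → K) (v : Fin d → M.Carrierᴹ) →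
      f (linearCombination M k v) N.≈ᴹ linearCombination N k (f ∘ v)
    linearCombination-homo {zero}  f 0-homo +-homo *-homo k v = 0-homo
    linearCombination-homo {suc d} f 0-homo +-homo *-homo k v = N.≈ᴹ-trans (+-homo _ _)
      (N.+ᴹ-cong (*-homo _ _) (linearCombination-homo f 0-homo +-homo *-homo (k ∘ suc) (v ∘ suc)))

    -- The basis of `N` is lifted along surjectivity. Applying `f` to a dependency of the lifts
    -- gives one of `w`, and injectivity pulls expansions in `w` back to `M`.
    HasDimension-≅ : M ≅ N → HasDimension N d → HasDimension M d
    HasDimension-≅ {d} (f , iso) (w , w-independent , w-spanning) = v , v-independent , v-spanning
      where
      open IsModuleIsomorphism iso
      v : Fin d → M.Carrierᴹ
      v i = proj₁ (surjective (w i))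

      f-linearCombination : ∀ k → f (linearCombination M k v) N.≈ᴹ linearCombination N k w
      f-linearCombination k = N.≈ᴹ-trans
        (linearCombination-homo f 0ᴹ-homo +ᴹ-homo *ₗ-homo k v)
        (linearCombination-cong N (λ _ → R.refl) (λ i → proj₂ (surjective (w i)) M.≈ᴹ-refl))

      v-independent : LinearlyIndependent M v
      v-independent k eq = w-independent k
        (N.≈ᴹ-trans (N.≈ᴹ-sym (f-linearCombination k)) (N.≈ᴹ-trans (⟦⟧-cong eq) 0ᴹ-homo))

      v-spanning : Spanning M v
      v-spanning x = let k , eq = w-spanning (f x) in
        k , injective (N.≈ᴹ-trans eq (N.≈ᴹ-sym (f-linearCombination k)))

  module _ (M : Module R m ℓm) (N : Module R m′ ℓm′) where
    private
      module M = Module M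
      module N = Module N
      module M×N = Module (M ×ᴹ N)

    HasDimension-×ᴹ : HasDimension M d → HasDimension N e → HasDimension (M ×ᴹ N) (d + e)
    HasDimension-×ᴹ {d} {e} (v , v-independent , v-spanning) (w , w-independent , w-spanning) =
      u , u-independent , u-spanning
      where
      u : Fin (d + e) → M×N.Carrierᴹ
      u = (λ i → v i , N.0ᴹ) ++ (λ j → M.0ᴹ , w j)

      u-linearCombination : ∀ k → linearCombination (M ×ᴹ N) k u M×N.≈ᴹ
        (linearCombination M (k ∘ (_↑ˡ e)) v , linearCombination N (k ∘ (d ↑ʳ_)) w)
      u-linearCombination k = begin
        linearCombination (M ×ᴹ N) k u
          ≈⟨ linearCombination-++ (M ×ᴹ N) k (λ i → v i , N.0ᴹ) (λ j → M.0ᴹ , w j) ⟩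
        linearCombination (M ×ᴹ N) k₁ (λ i → v i , N.0ᴹ) M×N.+ᴹ linearCombination (M ×ᴹ N) k₂ (λ j → M.0ᴹ , w j)
          ≈⟨ M×N.+ᴹ-cong
               (linearCombination-homo M (M ×ᴹ N) (_, N.0ᴹ) M×N.≈ᴹ-refl
                 (λ _ _ → M.≈ᴹ-refl , N.≈ᴹ-sym (N.+ᴹ-identityˡ N.0ᴹ))
                 (λ x _ → M.≈ᴹ-refl , N.≈ᴹ-sym (N.*ₗ-zeroʳ x)) k₁ v)
               (linearCombination-homo N (M ×ᴹ N) (M.0ᴹ ,_) M×N.≈ᴹ-refl
                 (λ _ _ → M.≈ᴹ-sym (M.+ᴹ-identityˡ M.0ᴹ) , N.≈ᴹ-refl)
                 (λ x _ → M.≈ᴹ-sym (M.*ₗ-zeroʳ x) , N.≈ᴹ-refl) k₂ w) ⟨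
        (linearCombination M k₁ v M.+ᴹ M.0ᴹ , N.0ᴹ N.+ᴹ linearCombination N k₂ w)
          ≈⟨ M.+ᴹ-identityʳ _ , N.+ᴹ-identityˡ _ ⟩
        (linearCombination M k₁ v , linearCombination N k₂ w) ∎
        where
        open ≈-Reasoning M×N.≈ᴹ-setoid
        k₁ : Fin d → K
        k₁ = k ∘ (_↑ˡ e)
        k₂ : Fin e → K
        k₂ = k ∘ (d ↑ʳ_)

      u-independent : LinearlyIndependent (M ×ᴹ N) u
      -- Every index is the `join` of its splitting, so the two blocks of coefficients can be
      -- treated separately, each by one component of `eq′`.
      u-independent k eq i = ≡.subst (λ i → k i R.≈ R.0#) (Fin.join-splitAt d e i) (vanishes (splitAt d i))
        where
        eq′ = M×N.≈ᴹ-trans (M×N.≈ᴹ-sym (u-linearCombination k)) eq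
        vanishes : ∀ s → k (join d e s) R.≈ R.0#
        vanishes (inj₁ i) = v-independent (k ∘ (_↑ˡ e)) (proj₁ eq′) i
        vanishes (inj₂ j) = w-independent (k ∘ (d ↑ʳ_)) (proj₂ eq′) j

      u-spanning : Spanning (M ×ᴹ N) u
      u-spanning (x , y) =
        let k₁ , eq₁ = v-spanning x
            k₂ , eq₂ = w-spanning y
        in k₁ ++ k₂ , M×N.≈ᴹ-sym (M×N.≈ᴹ-trans (u-linearCombination (k₁ ++ k₂))
          ( M.≈ᴹ-trans (linearCombination-congˡ M v (R.reflexive ∘ Vector.lookup-++ˡ k₁ k₂)) (M.≈ᴹ-sym eq₁)
          , N.≈ᴹ-trans (linearCombination-congˡ N w (R.reflexive ∘ Vector.lookup-++ʳ k₁ k₂)) (N.≈ᴹ-sym eq₂)))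

  -- The indicator functions of the points form the basis, and the coordinates of a function are its
  -- values.
  HasDimension-functionModule : (S : Setoid c ℓ) → Inverse S (≡.setoid (Fin n)) →
    HasDimension (functionModule {R = R} S) n
  HasDimension-functionModule {n = n} S finite = δ , δ-independent , δ-spanning
    where
    open Inverse finite
    V = functionModule {R = R} S

    δ : Fin n → Func S R.setoid
    δ i = record
      { to   = λ x → indicator i (to x)
      ; cong = λ x≈y → R.reflexive (≡.cong (indicator i) (to-cong x≈y))
      }

    δ-linearCombination : ∀ k x → linearCombination V k δ ⟨$⟩ x R.≈ k (to x)
    δ-linearCombination k x = begin
      linearCombination V k δ ⟨$⟩ x
        -- Evaluation at `x` is linear into the ring regarded as a module over itself.
        ≈⟨ linearCombination-homo V (TensorUnit.⟨module⟩ {R = R}) (_⟨$⟩ x) R.refl (λ _ _ → R.refl) (λ _ _ → R.refl) k δ ⟩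
      linearCombination (TensorUnit.⟨module⟩ {R = R}) k (λ i → indicator i (to x))
        ≈⟨ sum-single R.+-commutativeMonoid (to x) (λ i → k i R.* indicator i (to x))
             (λ i i≢x → R.trans (R.*-congˡ (R.reflexive (indicator-≢ (i≢x ∘ ≡.sym)))) (R.zeroʳ (k i))) ⟩
      k (to x) R.* indicator (to x) (to x)
        ≈⟨ R.*-congˡ (R.reflexive (indicator-≡ (to x))) ⟩
      k (to x) R.* R.1#
        ≈⟨ R.*-identityʳ (k (to x)) ⟩
      k (to x) ∎
      where open ≈-Reasoning R.setoid

    δ-independent : LinearlyIndependent V δ
    δ-independent k eq i = begin
      k i                                 ≡⟨ ≡.cong k (strictlyInverseˡ i) ⟨
      k (to (from i))                     ≈⟨ δ-linearCombination k (from i) ⟨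
      linearCombination V k δ ⟨$⟩ from i  ≈⟨ eq (from i) ⟩
      R.0#                                ∎
      where open ≈-Reasoning R.setoid

    δ-spanning : Spanning V δ
    δ-spanning f = (λ i → f ⟨$⟩ from i) , λ x → R.trans
      (Func.cong f (Setoid.sym S (strictlyInverseʳ x)))
      (R.sym (δ-linearCombination (λ i → f ⟨$⟩ from i) x))

-- Numbering the coefficient vectors over `𝔽₂`.

private
  module 2↔Bool = Inverse Fin.2↔Bool

funToFin-cong : {f g : Fin d → Fin e} → f ≗ g → funToFin f ≡ funToFin g
funToFin-cong {zero}  f≗g = ≡.refl
funToFin-cong {suc d} f≗g = ≡.cong₂ combine (f≗g zero) (funToFin-cong (f≗g ∘ suc))

-- Numbering makes a search through all coefficient vectors decidable and lets them be counted. On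
-- the side of functions, `encode` and `decode` are inverse up to pointwise equality, hence
-- `encode-cong`.
encode : (Fin d → Bool) → Fin (2 ^ d)
encode k = funToFin (2↔Bool.from ∘ k)

decode : Fin (2 ^ d) → Fin d → Bool
decode j = 2↔Bool.to ∘ finToFun j

encode-cong : {k k′ : Fin d → Bool} → k ≗ k′ → encode k ≡ encode k′
encode-cong k≗k′ = funToFin-cong (≡.cong 2↔Bool.from ∘ k≗k′)

decode-encode : (k : Fin d → Bool) → decode (encode k) ≗ k
decode-encode k i = ≡.trans (≡.cong 2↔Bool.to (Fin.finToFun-funToFin (2↔Bool.from ∘ k) i)) (2↔Bool.strictlyInverseˡ (k i))

encode-decode : (j : Fin (2 ^ d)) → encode {d} (decode j) ≡ j
encode-decode {d} j = ≡.trans (funToFin-cong {d} (λ i → 2↔Bool.strictlyInverseʳ (finToFun j i))) (Fin.funToFin-finToFin {d} j)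

-- Existence of bases and uniqueness of dimension over `𝔽₂`.

module _ (M : Module 𝔽₂ m ℓm) where
  open Module M
  open Sum +ᴹ-commutativeMonoid using (sum-remove)
  open ≈-Reasoning ≈ᴹ-setoid

  -- The dependency k is used to clear the coefficient of v i, without changing the value.
  Spanning-removeAt : {v : Fin (suc d) → Carrierᴹ} {k : Fin (suc d) → Bool} {i : Fin (suc d)} →
    linearCombination M k v ≈ᴹ 0ᴹ → k i ≡ true → Spanning M v → Spanning M (removeAt v i)
  Spanning-removeAt {v = v} {k} {i} kv≈0 ki≡1 spanning x = removeAt k′ i , (begin
    x                               ≈⟨ +ᴹ-identityʳ x ⟨
    x +ᴹ 0ᴹ                         ≈⟨ +ᴹ-cong x≈hv (≈ᴹ-sym (*ₗ-zeroʳ (h i))) ⟩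
    linearCombination M h v +ᴹ h i *ₗ 0ᴹ
      ≈⟨ +ᴹ-congˡ (≈ᴹ-trans (linearCombination-* M (h i) k v) (*ₗ-cong ≡.refl kv≈0)) ⟨
    linearCombination M h v +ᴹ linearCombination M (λ j → h i ∧ k j) v
      ≈⟨ linearCombination-+ M h (λ j → h i ∧ k j) v ⟨
    linearCombination M k′ v
      ≈⟨ sum-remove {i = i} (λ j → k′ j *ₗ v j) ⟩
    k′ i *ₗ v i +ᴹ linearCombination M (removeAt k′ i) (removeAt v i)
      ≈⟨ +ᴹ-congʳ (≈ᴹ-trans (*ₗ-cong k′i≡0 ≈ᴹ-refl) (*ₗ-zeroˡ (v i))) ⟩
    0ᴹ +ᴹ linearCombination M (removeAt k′ i) (removeAt v i)
      ≈⟨ +ᴹ-identityˡ _ ⟩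
    linearCombination M (removeAt k′ i) (removeAt v i) ∎)
    where
    h = proj₁ (spanning x)
    x≈hv = proj₂ (spanning x)
    k′ : Fin _ → Bool
    k′ j = h j xor (h i ∧ k j)
    k′i≡0 : k′ i ≡ false
    k′i≡0 = ≡.trans (≡.cong (λ t → h i xor (h i ∧ t)) ki≡1)
      (≡.trans (≡.cong (h i xor_) (Bool.∧-identityʳ (h i))) (Bool.xor-same (h i)))

  -- All `2 ^ suc d` coefficient vectors are searched for a nontrivial dependency. If there is one,
  -- a vector with coefficient `true` is dropped and the search repeats on the shorter family;
  -- otherwise the family is a basis.
  Spanning⇒FiniteDimensional : Decidable (_≈ᴹ 0ᴹ) → {v : Fin d → Carrierᴹ} → Spanning M v → FiniteDimensional M
  Spanning⇒FiniteDimensional {zero}  ≈0? {v} spanning = 0 , v , (λ _ _ ()) , spanning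
  Spanning⇒FiniteDimensional {suc d} ≈0? {v} spanning
    with Fin.any? (λ j → ≈0? (linearCombination M (decode {suc d} j) v) ×-dec
                         Fin.any? (λ i → decode {suc d} j i Bool.≟ true))
  ... | yes (j , jv≈0 , i , ji≡1) = Spanning⇒FiniteDimensional ≈0?
    (Spanning-removeAt {v = v} {k = decode {suc d} j} {i} jv≈0 ji≡1 spanning)
  ... | no  ¬dependent            = suc d , v , independent , spanning
    where
    independent : LinearlyIndependent M v
    independent k kv≈0 i with k i in ki≡
    ... | false = ≡.refl
    ... | true  = ⊥-elim (¬dependent
      ( encode k
      , ≈ᴹ-trans (linearCombination-congˡ M v (decode-encode k)) kv≈0
      , i , ≡.trans (decode-encode k i) ki≡))

  -- A vector vanishes exactly when its finitely many coordinates do.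
  IsBasis⇒≈0? : {v : Fin d → Carrierᴹ} → IsBasis M v → Decidable (_≈ᴹ 0ᴹ)
  IsBasis⇒≈0? {v = v} (independent , spanning) x = map′
    (λ k≡0 → ≈ᴹ-trans x≈kv (linearCombination-zero M v k≡0))
    (λ x≈0 → independent k (≈ᴹ-trans (≈ᴹ-sym x≈kv) x≈0))
    (Fin.all? (λ i → k i Bool.≟ false))
    where
    k = proj₁ (spanning x)
    x≈kv = proj₂ (spanning x)

  -- In characteristic 2 the difference of `k` and `k′` is their pointwise `xor`, and two equal
  -- combinations add up to zero.
  LinearlyIndependent⇒injective : {v : Fin d → Carrierᴹ} → LinearlyIndependent M v →
    ∀ {k k′} → linearCombination M k v ≈ᴹ linearCombination M k′ v → k ≗ k′
  LinearlyIndependent⇒injective {v = v} independent {k} {k′} eq i =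
    xor≡false⇒≡ (k i) (k′ i) (independent (λ i → k i xor k′ i) (begin
      linearCombination M (λ i → k i xor k′ i) v
        ≈⟨ linearCombination-+ M k k′ v ⟩
      linearCombination M k v +ᴹ linearCombination M k′ v
        ≈⟨ +ᴹ-congʳ eq ⟩
      linearCombination M k′ v +ᴹ linearCombination M k′ v
        ≈⟨ linearCombination-+ M k′ k′ v ⟨
      linearCombination M (λ i → k′ i xor k′ i) v
        ≈⟨ linearCombination-zero M v (Bool.xor-same ∘ k′) ⟩
      0ᴹ ∎) i)
    where
    xor≡false⇒≡ : ∀ x y → x xor y ≡ false → x ≡ y
    xor≡false⇒≡ false y     eq = ≡.sym eq
    xor≡false⇒≡ true  true  eq = ≡.refl

  -- Taking coordinates with respect to w injects the 2 ^ d combinations of v into 2 ^ e coordinate vectors.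
  independent≤spanning : {v : Fin d → Carrierᴹ} {w : Fin e → Carrierᴹ} →
    LinearlyIndependent M v → Spanning M w → d ≤ e
  independent≤spanning {d} {e} {v} {w} independent spanning =
    -- The injection gives `2 ^ d ≤ 2 ^ e`, which strict monotonicity of powers of 2 forbids when
    -- `e < d`. Here `ℕ.≤-refl` proves `1 < 2`.
    ℕ.≮⇒≥ (λ e<d → ℕ.<⇒≱ (ℕ.^-monoʳ-< 2 ℕ.≤-refl e<d) (Fin.injective⇒≤ f-injective))
    where
    -- The family `w` may be dependent, so this is one choice of coefficients among several; it
    -- still determines the vector, which is enough.
    coordinates : Carrierᴹ → Fin e → Bool
    coordinates x = proj₁ (spanning x)

    coordinates-injective : ∀ {x y} → coordinates x ≗ coordinates y → x ≈ᴹ y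
    coordinates-injective {x} {y} eq = begin
      x                                      ≈⟨ proj₂ (spanning x) ⟩
      linearCombination M (coordinates x) w  ≈⟨ linearCombination-congˡ M w eq ⟩
      linearCombination M (coordinates y) w  ≈⟨ proj₂ (spanning y) ⟨
      y                                      ∎

    f : Fin (2 ^ d) → Fin (2 ^ e)
    f i = encode (coordinates (linearCombination M (decode i) v))

    encode-injective : {k k′ : Fin e → Bool} → encode k ≡ encode k′ → k ≗ k′
    encode-injective {k} {k′} eq i = ≡.trans (≡.sym (decode-encode k i))
      (≡.trans (≡.cong (λ j → decode j i) eq) (decode-encode k′ i))

    f-injective : ∀ {i j} → f i ≡ f j → i ≡ j
    f-injective {i} {j} eq = ≡.trans (≡.sym (encode-decode {d} i)) (≡.trans
      (encode-cong (LinearlyIndependent⇒injective independent (coordinates-injective (encode-injective eq))))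
      (encode-decode {d} j))

  HasDimension-unique : HasDimension M d → HasDimension M e → d ≡ e
  HasDimension-unique (_ , v-independent , v-spanning) (_ , w-independent , w-spanning) =
    ℕ.≤-antisym (independent≤spanning v-independent w-spanning) (independent≤spanning w-independent v-spanning)

-- Decidable subspaces of a finite-dimensional space.

module _ (M : Module 𝔽₂ m ℓm) {P : Pred (Module.Carrierᴹ M) p} (P-isSubmodule : IsSubmodule M P)
         (P-resp : P Respects Module._≈ᴹ_ M) (P? : Decidable P) where
  open Module M
  open ≈-Reasoning ≈ᴹ-setoid
  private
    N = submodule M P-isSubmodule
    module N = Module N

  submodule-finiteDimensional : HasDimension M d → FiniteDimensional N
  submodule-finiteDimensional {d} (v , basis) =
    Spanning⇒FiniteDimensional N (λ x → IsBasis⇒≈0? M basis (proj₁ x)) spanning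
    where
    -- Combinations outside the subspace are replaced by zero, which keeps the family indexed by all
    -- of `Fin (2 ^ d)`.
    member : ∀ {x} → Dec (P x) → N.Carrierᴹ
    member {x} (yes px) = x , px
    member     (no  _)  = N.0ᴹ

    member-≈ : ∀ {x} (px? : Dec (P x)) → P x → proj₁ (member px?) ≈ᴹ x
    member-≈ (yes _)   px = ≈ᴹ-refl
    member-≈ (no  ¬px) px = ⊥-elim (¬px px)

    u : Fin (2 ^ d) → N.Carrierᴹ
    u j = member (P? (linearCombination M (decode j) v))

    spanning : Spanning N u
    -- Up to equality `x` is itself a member of the family, at the index encoding its coordinates,
    -- so a single coefficient suffices.
    spanning X@(x , px) = indicator {R = 𝔽₂} (encode k) ,
      N.≈ᴹ-sym {linearCombination N (indicator {R = 𝔽₂} (encode k)) u} {X} (begin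
      proj₁ (linearCombination N (indicator {R = 𝔽₂} (encode k)) u)
        ≈⟨ linearCombination-indicator N (encode k) u ⟩
      proj₁ (u (encode k))
        -- The enumerated combination is only equal to `x` in the sense of `≈ᴹ`, so membership is
        -- carried over by `P-resp`.
        ≈⟨ member-≈ (P? _) (P-resp (≈ᴹ-sym kv≈x) px) ⟩
      linearCombination M (decode (encode k)) v
        ≈⟨ kv≈x ⟩
      x ∎)
      where
      k = proj₁ (proj₂ basis x)
      kv≈x : linearCombination M (decode (encode k)) v ≈ᴹ x
      kv≈x = ≈ᴹ-trans (linearCombination-congˡ M v (decode-encode k)) (≈ᴹ-sym (proj₂ (proj₂ basis x)))

-- Finite setoids: counting vectors and deciding universal statements.

module _ (S : Setoid c ℓ) (finite : Inverse S (≡.setoid (Fin n))) where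
  open Inverse finite
  open Setoid S using (Carrier; _≈_)

  -- A vector of length `k` is read as a numeral with `k` digits in base `n`.
  Vec-finite : ∀ k → Inverse (Pointwise.setoid S k) (≡.setoid (Fin (n ^ k)))
  Vec-finite k = record
    { to        = toᵛ
    ; from      = fromᵛ k
    ; to-cong   = toᵛ-cong
    ; from-cong = λ { ≡.refl → Setoid.refl (Pointwise.setoid S k) }
    ; inverse   = (λ {i} xs≈ → ≡.trans (toᵛ-cong xs≈) (toᵛ-fromᵛ k i))
                , (λ { {xs} ≡.refl → fromᵛ-toᵛ xs })
    }
    where
    toᵛ : ∀ {k} → Vec Carrier k → Fin (n ^ k)
    toᵛ []       = zero
    toᵛ (x ∷ xs) = combine (to x) (toᵛ xs)

    fromᵛ : ∀ k → Fin (n ^ k) → Vec Carrier k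
    fromᵛ zero    _ = []
    fromᵛ (suc k) i = let j , i′ = remQuot {n} (n ^ k) i in from j ∷ fromᵛ k i′

    toᵛ-cong : ∀ {k} {xs ys : Vec Carrier k} → Pointwise.Pointwise _≈_ xs ys → toᵛ xs ≡ toᵛ ys
    toᵛ-cong []            = ≡.refl
    toᵛ-cong (x≈y ∷ xs≈ys) = ≡.cong₂ combine (to-cong x≈y) (toᵛ-cong xs≈ys)

    toᵛ-fromᵛ : ∀ k i → toᵛ (fromᵛ k i) ≡ i
    toᵛ-fromᵛ zero    zero = ≡.refl
    toᵛ-fromᵛ (suc k) i    = ≡.trans
      (≡.cong₂ combine (strictlyInverseˡ _) (toᵛ-fromᵛ k _))
      (Fin.combine-remQuot {n} (n ^ k) i)

    fromᵛ-toᵛ : ∀ {k} (xs : Vec Carrier k) → Pointwise.Pointwise _≈_ (fromᵛ k (toᵛ xs)) xs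
    fromᵛ-toᵛ []               = []
    -- `remQuot` of a `combine` does not reduce, so digit and remainder are transported together as
    -- one pair.
    fromᵛ-toᵛ {suc k} (x ∷ xs) = ≡.subst
      (λ (j , i) → Pointwise.Pointwise _≈_ (from j ∷ fromᵛ k i) (x ∷ xs))
      (≡.sym (Fin.remQuot-combine (to x) (toᵛ xs)))
      (strictlyInverseʳ x ∷ fromᵛ-toᵛ xs)

  -- It suffices to test the `n` representatives `from i`: every `x` is equivalent to `from (to x)`.
  finite-∀? : {P : Pred Carrier p} → P Respects _≈_ → Decidable P → Dec (∀ x → P x)
  finite-∀? resp P? = map′ (λ ∀P x → resp (strictlyInverseʳ x) (∀P (to x))) (λ ∀P i → ∀P (from i))
    (Fin.all? (λ i → P? (from i)))

-- Compatible pairs, cocycles and the two maps between them.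

module _ (L : Loop c ℓ) where
  private
    module L = Loop L
    module 𝒞¹ = Module (𝒞 L 1)
    module 𝒞² = Module (𝒞 L 2)
    module 𝒞²δ = Module (𝒞²δ L)
    module 𝒵²×𝒞¹ = Module (𝒵² L ×ᴹ 𝒞 L 1)
  open L using (_∙_; _≈_; ε) renaming (Carrier to |L|)
  open xor-∧-Solver using (solve; _:=_; _:+_; _:*_)

  private
    _⟪_,_⟫ : Cochain L 2 → |L| → |L| → Bool
    _⟪_,_⟫ = _⟨_,_⟩ L

    _⟦_⟧ : Cochain L 1 → |L| → Bool
    f ⟦ x ⟧ = f ⟨$⟩ (x ∷ [])

  cong¹ : ∀ f {x y} → x ≈ y → f ⟦ x ⟧ ≡ f ⟦ y ⟧
  cong¹ f x≈y = Func.cong f (x≈y ∷ [])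

  cong² : ∀ ψ {x y z w} → x ≈ y → z ≈ w → ψ ⟪ x , z ⟫ ≡ ψ ⟪ y , w ⟫
  cong² ψ x≈y z≈w = Func.cong ψ (x≈y ∷ z≈w ∷ [])

  coboundary : Cochain L 1 → Cochain L 2
  coboundary f = record
    { to   = λ { (a ∷ b ∷ []) → f ⟦ a ∙ b ⟧ xor (f ⟦ a ⟧ xor f ⟦ b ⟧) }
    ; cong = λ { (a≈a′ ∷ b≈b′ ∷ []) → ≡.cong₂ _xor_ (cong¹ f (L.∙-cong a≈a′ b≈b′))
                                        (≡.cong₂ _xor_ (cong¹ f a≈a′) (cong¹ f b≈b′)) }
    }

  onProduct : Cochain L 1 → Cochain L 2
  onProduct f = record
    { to   = λ { (a ∷ b ∷ []) → f ⟦ a ∙ b ⟧ }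
    ; cong = λ { (a≈a′ ∷ b≈b′ ∷ []) → cong¹ f (L.∙-cong a≈a′ b≈b′) }
    }

  atIdentity : Cochain L 2 → Cochain L 1
  atIdentity ψ = record
    { to   = λ { (x ∷ []) → ψ ⟪ ε , x ⟫ }
    ; cong = λ { (x≈y ∷ []) → cong² ψ L.refl x≈y }
    }

  difference : Cochain L 2 × Cochain L 2 → Cochain L 1
  difference (ψ , φ) = atIdentity φ 𝒞¹.+ᴹ atIdentity ψ

  -- In the compatibility equation at `(ε , ε , z)` both values of `φ` equal φ(ε,z) and cancel, so
  -- each value is compared with ψ(ε,ε).
  atIdentity-constant : ∀ {ψ φ} → IsCompatible L (ψ , φ) → ∀ x y → ψ ⟪ ε , x ⟫ ≡ ψ ⟪ ε , y ⟫
  atIdentity-constant {ψ} {φ} compatible x y = ≡.trans (≡.sym (swap x)) (swap y)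
    where
    swap : ∀ z → ψ ⟪ ε , ε ⟫ ≡ ψ ⟪ ε , z ⟫
    swap z = begin
      ψ ⟪ ε , ε ⟫
        ≡⟨ cancel (ψ ⟪ ε , ε ⟫) (φ ⟪ ε ∙ ε , z ⟫) ⟩
      (ψ ⟪ ε , ε ⟫ xor φ ⟪ ε ∙ ε , z ⟫) xor φ ⟪ ε ∙ ε , z ⟫
        ≡⟨ ≡.cong₂ _xor_ (compatible ε ε z) (cong² φ (L.identityˡ ε) (L.sym (L.identityˡ z))) ⟩
      (φ ⟪ ε , ε ∙ z ⟫ xor ψ ⟪ ε , z ⟫) xor φ ⟪ ε , ε ∙ z ⟫
        ≡⟨ solve 2 (λ s t → (s :+ t) :+ s := t) ≡.refl (φ ⟪ ε , ε ∙ z ⟫) (ψ ⟪ ε , z ⟫) ⟩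
      ψ ⟪ ε , z ⟫ ∎
      where
      open ≡.≡-Reasoning
      cancel : ∀ s t → s ≡ (s xor t) xor t
      cancel = solve 2 (λ s t → s := (s :+ t) :+ t) ≡.refl

  compatible⇒difference : ∀ {ψ φ} → IsCompatible L (ψ , φ) →
    ∀ a b → φ ⟪ a , b ⟫ ≡ ψ ⟪ a , b ⟫ xor difference (ψ , φ) ⟦ a ∙ b ⟧
  compatible⇒difference {ψ} {φ} compatible a b = begin
    φ ⟪ a , b ⟫
      ≡⟨ cong² φ (L.identityˡ a) L.refl ⟨
    φ ⟪ ε ∙ a , b ⟫
      ≡⟨ solve 2 (λ s t → s := (t :+ s) :+ t) ≡.refl (φ ⟪ ε ∙ a , b ⟫) (ψ ⟪ ε , a ⟫) ⟩
    (ψ ⟪ ε , a ⟫ xor φ ⟪ ε ∙ a , b ⟫) xor ψ ⟪ ε , a ⟫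
      -- Constancy trades ψ(ε,a) for ψ(ε,ab), which makes the correction term a function of the
      -- product alone.
      ≡⟨ ≡.cong₂ _xor_ (compatible ε a b) (atIdentity-constant {ψ} {φ} compatible a (a ∙ b)) ⟩
    (φ ⟪ ε , a ∙ b ⟫ xor ψ ⟪ a , b ⟫) xor ψ ⟪ ε , a ∙ b ⟫
      ≡⟨ solve 3 (λ s t u → (s :+ t) :+ u := t :+ (s :+ u)) ≡.refl (φ ⟪ ε , a ∙ b ⟫) (ψ ⟪ a , b ⟫) (ψ ⟪ ε , a ∙ b ⟫) ⟩
    ψ ⟪ a , b ⟫ xor (φ ⟪ ε , a ∙ b ⟫ xor ψ ⟪ ε , a ∙ b ⟫) ∎
    where open ≡.≡-Reasoning

  toCocycle : 𝒞²δ.Carrierᴹ → Module.Carrierᴹ (𝒵² L)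
  toCocycle ((ψ , φ) , compatible) = ψ 𝒞².+ᴹ coboundary f , λ a b c → begin
    (ψ ⟪ a , b ⟫ xor (f ⟦ a ∙ b ⟧ xor (f ⟦ a ⟧ xor f ⟦ b ⟧))) xor
    (ψ ⟪ a ∙ b , c ⟫ xor (f ⟦ (a ∙ b) ∙ c ⟧ xor (f ⟦ a ∙ b ⟧ xor f ⟦ c ⟧)))
      -- The two copies of f(ab) cancel. What remains is the left side of `compatible′` plus f(a) +
      -- f(b) + f(c), a term common to both sides of the cocycle equation.
      ≡⟨ solve 7 (λ ab a b ψab ψab-c ab-c c →
           (ψab :+ (ab :+ (a :+ b))) :+ (ψab-c :+ (ab-c :+ (ab :+ c)))
             := (ψab :+ (ψab-c :+ ab-c)) :+ (a :+ (b :+ c))) ≡.refl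
           (f ⟦ a ∙ b ⟧) (f ⟦ a ⟧) (f ⟦ b ⟧) (ψ ⟪ a , b ⟫) (ψ ⟪ a ∙ b , c ⟫) (f ⟦ (a ∙ b) ∙ c ⟧) (f ⟦ c ⟧) ⟩
    (ψ ⟪ a , b ⟫ xor (ψ ⟪ a ∙ b , c ⟫ xor f ⟦ (a ∙ b) ∙ c ⟧)) xor (f ⟦ a ⟧ xor (f ⟦ b ⟧ xor f ⟦ c ⟧))
      ≡⟨ ≡.cong (_xor (f ⟦ a ⟧ xor (f ⟦ b ⟧ xor f ⟦ c ⟧))) (compatible′ a b c) ⟩
    ((ψ ⟪ a , b ∙ c ⟫ xor f ⟦ a ∙ (b ∙ c) ⟧) xor ψ ⟪ b , c ⟫) xor (f ⟦ a ⟧ xor (f ⟦ b ⟧ xor f ⟦ c ⟧))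
      ≡⟨ solve 7 (λ bc a b ψbc ψa-bc a-bc c →
           ((ψa-bc :+ a-bc) :+ ψbc) :+ (a :+ (b :+ c))
             := (ψa-bc :+ (a-bc :+ (a :+ bc))) :+ (ψbc :+ (bc :+ (b :+ c)))) ≡.refl
           (f ⟦ b ∙ c ⟧) (f ⟦ a ⟧) (f ⟦ b ⟧) (ψ ⟪ b , c ⟫) (ψ ⟪ a , b ∙ c ⟫) (f ⟦ a ∙ (b ∙ c) ⟧) (f ⟦ c ⟧) ⟩
    (ψ ⟪ a , b ∙ c ⟫ xor (f ⟦ a ∙ (b ∙ c) ⟧ xor (f ⟦ a ⟧ xor f ⟦ b ∙ c ⟧))) xor
    (ψ ⟪ b , c ⟫ xor (f ⟦ b ∙ c ⟧ xor (f ⟦ b ⟧ xor f ⟦ c ⟧))) ∎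
    where
    open ≡.≡-Reasoning
    f : Cochain L 1
    f = difference (ψ , φ)
    compatible′ : ∀ a b c → ψ ⟪ a , b ⟫ xor (ψ ⟪ a ∙ b , c ⟫ xor f ⟦ (a ∙ b) ∙ c ⟧) ≡
                            (ψ ⟪ a , b ∙ c ⟫ xor f ⟦ a ∙ (b ∙ c) ⟧) xor ψ ⟪ b , c ⟫
    compatible′ a b c = begin
      ψ ⟪ a , b ⟫ xor (ψ ⟪ a ∙ b , c ⟫ xor f ⟦ (a ∙ b) ∙ c ⟧)
        ≡⟨ ≡.cong (ψ ⟪ a , b ⟫ xor_) (compatible⇒difference {ψ} {φ} compatible (a ∙ b) c) ⟨
      ψ ⟪ a , b ⟫ xor φ ⟪ a ∙ b , c ⟫
        ≡⟨ compatible a b c ⟩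
      φ ⟪ a , b ∙ c ⟫ xor ψ ⟪ b , c ⟫
        ≡⟨ ≡.cong (_xor ψ ⟪ b , c ⟫) (compatible⇒difference {ψ} {φ} compatible a (b ∙ c)) ⟩
      (ψ ⟪ a , b ∙ c ⟫ xor f ⟦ a ∙ (b ∙ c) ⟧) xor ψ ⟪ b , c ⟫ ∎

  fromCocycle : 𝒵²×𝒞¹.Carrierᴹ → 𝒞²δ.Carrierᴹ
  fromCocycle ((ζ , cocycle) , f) = (ψ , ψ 𝒞².+ᴹ onProduct f) , λ a b c → begin
    (ζ ⟪ a , b ⟫ xor (f ⟦ a ∙ b ⟧ xor (f ⟦ a ⟧ xor f ⟦ b ⟧))) xor
    ((ζ ⟪ a ∙ b , c ⟫ xor (f ⟦ (a ∙ b) ∙ c ⟧ xor (f ⟦ a ∙ b ⟧ xor f ⟦ c ⟧))) xor f ⟦ (a ∙ b) ∙ c ⟧)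
      -- Besides f(ab), also f((ab)c) now occurs twice, once from the coboundary and once from
      -- `onProduct`, so the cocycle equation of `ζ` applies directly.
      ≡⟨ solve 7 (λ ab a b ζab ζab-c ab-c c →
           (ζab :+ (ab :+ (a :+ b))) :+ ((ζab-c :+ (ab-c :+ (ab :+ c))) :+ ab-c)
             := (ζab :+ ζab-c) :+ (a :+ (b :+ c))) ≡.refl
           (f ⟦ a ∙ b ⟧) (f ⟦ a ⟧) (f ⟦ b ⟧) (ζ ⟪ a , b ⟫) (ζ ⟪ a ∙ b , c ⟫) (f ⟦ (a ∙ b) ∙ c ⟧) (f ⟦ c ⟧) ⟩
    (ζ ⟪ a , b ⟫ xor ζ ⟪ a ∙ b , c ⟫) xor (f ⟦ a ⟧ xor (f ⟦ b ⟧ xor f ⟦ c ⟧))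
      ≡⟨ ≡.cong (_xor (f ⟦ a ⟧ xor (f ⟦ b ⟧ xor f ⟦ c ⟧))) (cocycle a b c) ⟩
    (ζ ⟪ a , b ∙ c ⟫ xor ζ ⟪ b , c ⟫) xor (f ⟦ a ⟧ xor (f ⟦ b ⟧ xor f ⟦ c ⟧))
      ≡⟨ solve 7 (λ bc a b ζbc ζa-bc a-bc c →
           (ζa-bc :+ ζbc) :+ (a :+ (b :+ c))
             := ((ζa-bc :+ (a-bc :+ (a :+ bc))) :+ a-bc) :+ (ζbc :+ (bc :+ (b :+ c)))) ≡.refl
           (f ⟦ b ∙ c ⟧) (f ⟦ a ⟧) (f ⟦ b ⟧) (ζ ⟪ b , c ⟫) (ζ ⟪ a , b ∙ c ⟫) (f ⟦ a ∙ (b ∙ c) ⟧) (f ⟦ c ⟧) ⟩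
    ((ζ ⟪ a , b ∙ c ⟫ xor (f ⟦ a ∙ (b ∙ c) ⟧ xor (f ⟦ a ⟧ xor f ⟦ b ∙ c ⟧))) xor f ⟦ a ∙ (b ∙ c) ⟧) xor
    (ζ ⟪ b , c ⟫ xor (f ⟦ b ∙ c ⟧ xor (f ⟦ b ⟧ xor f ⟦ c ⟧))) ∎
    where
    open ≡.≡-Reasoning
    ψ : Cochain L 2
    ψ = ζ 𝒞².+ᴹ coboundary f

  split : 𝒞²δ.Carrierᴹ → 𝒵²×𝒞¹.Carrierᴹ
  split x = toCocycle x , difference (proj₁ x)

  -- The two components share the summand ζ + δf, which cancels at (ε,x) and leaves f(εx).
  difference-fromCocycle : ∀ y → difference (proj₁ (fromCocycle y)) 𝒞¹.≈ᴹ proj₂ y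
  difference-fromCocycle ((ζ , cocycle) , f) (x ∷ []) = ≡.trans
    (solve 2 (λ s t → (s :+ t) :+ s := t) ≡.refl
      (ζ ⟪ ε , x ⟫ xor (f ⟦ ε ∙ x ⟧ xor (f ⟦ ε ⟧ xor f ⟦ x ⟧))) (f ⟦ ε ∙ x ⟧))
    (cong¹ f (L.identityˡ x))

  coboundary-cong : ∀ {f g} → f 𝒞¹.≈ᴹ g → coboundary f 𝒞².≈ᴹ coboundary g
  coboundary-cong f≈g (a ∷ b ∷ []) =
    ≡.cong₂ _xor_ (f≈g (a ∙ b ∷ [])) (≡.cong₂ _xor_ (f≈g (a ∷ [])) (f≈g (b ∷ [])))

  xor-involutiveʳ : ∀ s t → (s xor t) xor t ≡ s
  xor-involutiveʳ = solve 2 (λ s t → (s :+ t) :+ t := s) ≡.refl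

  split-fromCocycle : ∀ y → split (fromCocycle y) 𝒵²×𝒞¹.≈ᴹ y
  split-fromCocycle y@((ζ , _) , f) =
    (λ ab → ≡.trans
      (≡.cong ((ζ 𝒞².+ᴹ coboundary f ⟨$⟩ ab) xor_)
        (coboundary-cong {difference (proj₁ (fromCocycle y))} {f} (difference-fromCocycle y) ab))
      (xor-involutiveʳ (ζ ⟨$⟩ ab) (coboundary f ⟨$⟩ ab)))
    , difference-fromCocycle y

  split-cong : ∀ {x y} → x 𝒞²δ.≈ᴹ y → split x 𝒵²×𝒞¹.≈ᴹ split y
  split-cong {x} {y} (ψ≈ψ′ , φ≈φ′) =
    (λ ab → ≡.cong₂ _xor_ (ψ≈ψ′ ab) (coboundary-cong {difference (proj₁ x)} {difference (proj₁ y)} difference-cong ab))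
    , difference-cong
    where
    difference-cong : difference (proj₁ x) 𝒞¹.≈ᴹ difference (proj₁ y)
    difference-cong (z ∷ []) = ≡.cong₂ _xor_ (φ≈φ′ (ε ∷ z ∷ [])) (ψ≈ψ′ (ε ∷ z ∷ []))

  -- The second component fixes f and hence δf, so the first one gives back ψ; then
  -- `compatible⇒difference` gives back φ.
  split-injective : ∀ {x y} → split x 𝒵²×𝒞¹.≈ᴹ split y → x 𝒞²δ.≈ᴹ y
  split-injective {(ψ , φ) , compatible} {(ψ′ , φ′) , compatible′} (ζ≈ζ′ , f≈f′) = ψ≈ψ′ , φ≈φ′
    where
    open ≡.≡-Reasoning
    f : Cochain L 1
    f = difference (ψ , φ)
    f′ : Cochain L 1
    f′ = difference (ψ′ , φ′)

    ψ≈ψ′ : ψ 𝒞².≈ᴹ ψ′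
    ψ≈ψ′ ab = begin
      ψ ⟨$⟩ ab
        ≡⟨ xor-involutiveʳ (ψ ⟨$⟩ ab) (coboundary f ⟨$⟩ ab) ⟨
      ((ψ ⟨$⟩ ab) xor (coboundary f ⟨$⟩ ab)) xor (coboundary f ⟨$⟩ ab)
        ≡⟨ ≡.cong₂ _xor_ (ζ≈ζ′ ab) (coboundary-cong {f} {f′} f≈f′ ab) ⟩
      ((ψ′ ⟨$⟩ ab) xor (coboundary f′ ⟨$⟩ ab)) xor (coboundary f′ ⟨$⟩ ab)
        ≡⟨ xor-involutiveʳ (ψ′ ⟨$⟩ ab) (coboundary f′ ⟨$⟩ ab) ⟩
      ψ′ ⟨$⟩ ab ∎

    φ≈φ′ : φ 𝒞².≈ᴹ φ′
    φ≈φ′ (a ∷ b ∷ []) = begin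
      φ ⟪ a , b ⟫
        ≡⟨ compatible⇒difference {ψ} {φ} compatible a b ⟩
      ψ ⟪ a , b ⟫ xor f ⟦ a ∙ b ⟧
        ≡⟨ ≡.cong₂ _xor_ (ψ≈ψ′ (a ∷ b ∷ [])) (f≈f′ (a ∙ b ∷ [])) ⟩
      ψ′ ⟪ a , b ⟫ xor f′ ⟦ a ∙ b ⟧
        ≡⟨ compatible⇒difference {ψ′} {φ′} compatible′ a b ⟨
      φ′ ⟪ a , b ⟫ ∎

  -- Linearity of `split` and the isomorphism.

  difference-+ : ∀ x y → difference (proj₁ (x 𝒞²δ.+ᴹ y)) 𝒞¹.≈ᴹ difference (proj₁ x) 𝒞¹.+ᴹ difference (proj₁ y)
  difference-+ ((ψ , φ) , _) ((ψ′ , φ′) , _) (z ∷ []) =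
    solve 4 (λ s s′ t t′ → (s :+ s′) :+ (t :+ t′) := (s :+ t) :+ (s′ :+ t′)) ≡.refl
      (φ ⟪ ε , z ⟫) (φ′ ⟪ ε , z ⟫) (ψ ⟪ ε , z ⟫) (ψ′ ⟪ ε , z ⟫)

  difference-* : ∀ k x → difference (proj₁ (k 𝒞²δ.*ₗ x)) 𝒞¹.≈ᴹ k 𝒞¹.*ₗ difference (proj₁ x)
  difference-* k ((ψ , φ) , _) (z ∷ []) = ≡.sym (Bool.∧-distribˡ-xor k (φ ⟪ ε , z ⟫) (ψ ⟪ ε , z ⟫))

  coboundary-+ : ∀ f g → coboundary (f 𝒞¹.+ᴹ g) 𝒞².≈ᴹ coboundary f 𝒞².+ᴹ coboundary g
  coboundary-+ f g (a ∷ b ∷ []) =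
    solve 6 (λ x x′ y y′ z z′ → (x :+ x′) :+ ((y :+ y′) :+ (z :+ z′)) := (x :+ (y :+ z)) :+ (x′ :+ (y′ :+ z′))) ≡.refl
      (f ⟦ a ∙ b ⟧) (g ⟦ a ∙ b ⟧) (f ⟦ a ⟧) (g ⟦ a ⟧) (f ⟦ b ⟧) (g ⟦ b ⟧)

  coboundary-* : ∀ k f → coboundary (k 𝒞¹.*ₗ f) 𝒞².≈ᴹ k 𝒞².*ₗ coboundary f
  coboundary-* k f (a ∷ b ∷ []) =
    solve 4 (λ k x y z → k :* x :+ (k :* y :+ k :* z) := k :* (x :+ (y :+ z))) ≡.refl
      k (f ⟦ a ∙ b ⟧) (f ⟦ a ⟧) (f ⟦ b ⟧)

  split-+ : ∀ x y → split (x 𝒞²δ.+ᴹ y) 𝒵²×𝒞¹.≈ᴹ split x 𝒵²×𝒞¹.+ᴹ split y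
  split-+ x@((ψ , _) , _) y@((ψ′ , _) , _) = (λ ab → begin
    ((ψ ⟨$⟩ ab) xor (ψ′ ⟨$⟩ ab)) xor (coboundary (difference (proj₁ (x 𝒞²δ.+ᴹ y))) ⟨$⟩ ab)
      ≡⟨ ≡.cong (((ψ ⟨$⟩ ab) xor (ψ′ ⟨$⟩ ab)) xor_) (≡.trans
           (coboundary-cong {difference (proj₁ (x 𝒞²δ.+ᴹ y))} {f 𝒞¹.+ᴹ f′} (difference-+ x y) ab)
           (coboundary-+ f f′ ab)) ⟩
    ((ψ ⟨$⟩ ab) xor (ψ′ ⟨$⟩ ab)) xor ((coboundary f ⟨$⟩ ab) xor (coboundary f′ ⟨$⟩ ab))
      ≡⟨ solve 4 (λ s s′ t t′ → (s :+ s′) :+ (t :+ t′) := (s :+ t) :+ (s′ :+ t′)) ≡.refl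
           (ψ ⟨$⟩ ab) (ψ′ ⟨$⟩ ab) (coboundary f ⟨$⟩ ab) (coboundary f′ ⟨$⟩ ab) ⟩
    ((ψ ⟨$⟩ ab) xor (coboundary f ⟨$⟩ ab)) xor ((ψ′ ⟨$⟩ ab) xor (coboundary f′ ⟨$⟩ ab)) ∎)
    , difference-+ x y
    where
    open ≡.≡-Reasoning
    f : Cochain L 1
    f = difference (proj₁ x)
    f′ : Cochain L 1
    f′ = difference (proj₁ y)

  split-* : ∀ k x → split (k 𝒞²δ.*ₗ x) 𝒵²×𝒞¹.≈ᴹ k 𝒵²×𝒞¹.*ₗ split x
  split-* k x@((ψ , _) , _) = (λ ab → begin
    (k ∧ (ψ ⟨$⟩ ab)) xor (coboundary (difference (proj₁ (k 𝒞²δ.*ₗ x))) ⟨$⟩ ab)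
      ≡⟨ ≡.cong ((k ∧ (ψ ⟨$⟩ ab)) xor_) (≡.trans
           (coboundary-cong {difference (proj₁ (k 𝒞²δ.*ₗ x))} {k 𝒞¹.*ₗ f} (difference-* k x) ab)
           (coboundary-* k f ab)) ⟩
    (k ∧ (ψ ⟨$⟩ ab)) xor (k ∧ (coboundary f ⟨$⟩ ab))
      ≡⟨ Bool.∧-distribˡ-xor k (ψ ⟨$⟩ ab) (coboundary f ⟨$⟩ ab) ⟨
    k ∧ ((ψ ⟨$⟩ ab) xor (coboundary f ⟨$⟩ ab)) ∎)
    , difference-* k x
    where
    open ≡.≡-Reasoning
    f : Cochain L 1
    f = difference (proj₁ x)

  split-isModuleHomomorphism : IsModuleHomomorphism 𝒞²δ.rawModule 𝒵²×𝒞¹.rawModule split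
  split-isModuleHomomorphism = record
    { isBimoduleHomomorphism = record
      { +ᴹ-isGroupHomomorphism = record
        { isMonoidHomomorphism = record
          { isMagmaHomomorphism = record
            { isRelHomomorphism = record { cong = λ {x} {y} → split-cong {x} {y} }
            ; homo = split-+
            }
          ; ε-homo = (λ { (_ ∷ _ ∷ []) → ≡.refl }) , (λ { (_ ∷ []) → ≡.refl })
          }
        -- Negation on `𝔽₂` is the identity, so both sides compute to the same value.
        ; ⁻¹-homo = λ _ → (λ { (_ ∷ _ ∷ []) → ≡.refl }) , (λ { (_ ∷ []) → ≡.refl })
        }
      ; *ₗ-homo = split-*
      -- The right action on both modules is defined as the left action with its arguments
      -- exchanged.
      ; *ᵣ-homo = split-*
      }
    }

  𝒞²δ≅𝒵²×𝒞¹ : 𝒞²δ L ≅ 𝒵² L ×ᴹ 𝒞 L 1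
  𝒞²δ≅𝒵²×𝒞¹ = split , record
    { isModuleMonomorphism = record
      { isModuleHomomorphism = split-isModuleHomomorphism
      ; injective            = λ {x} {y} → split-injective {x} {y}
      }
    -- Surjectivity for setoids asks that everything equal to the chosen preimage also map to `y`,
    -- hence the use of `split-cong`.
    ; surjective = λ y → fromCocycle y , λ {z} z≈ →
        𝒵²×𝒞¹.≈ᴹ-trans {split z} {split (fromCocycle y)} {y} (split-cong {z} {fromCocycle y} z≈) (split-fromCocycle y)
    }

  -- Deciding the cocycle condition and counting dimensions.

  IsCocycle-resp : IsCocycle L Respects 𝒞²._≈ᴹ_
  IsCocycle-resp ψ≈ψ′ cocycle a b c = ≡.trans
    (≡.sym (≡.cong₂ _xor_ (ψ≈ψ′ (a ∷ b ∷ [])) (ψ≈ψ′ (a ∙ b ∷ c ∷ []))))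
    (≡.trans (cocycle a b c) (≡.cong₂ _xor_ (ψ≈ψ′ (a ∷ b ∙ c ∷ [])) (ψ≈ψ′ (b ∷ c ∷ []))))

  module _ (n : ℕ) (finite : HasOrder L n) where

    IsCocycle? : Decidable (IsCocycle L)
    IsCocycle? ψ =
      finite-∀? L.setoid finite (λ a≈a′ p b c → resp a≈a′ L.refl L.refl (p b c)) λ a →
      finite-∀? L.setoid finite (λ b≈b′ p c → resp L.refl b≈b′ L.refl (p c)) λ b →
      finite-∀? L.setoid finite (λ c≈c′ p → resp L.refl L.refl c≈c′ p) λ c →
      (ψ ⟪ a , b ⟫ xor ψ ⟪ a ∙ b , c ⟫) Bool.≟ (ψ ⟪ a , b ∙ c ⟫ xor ψ ⟪ b , c ⟫)
      where
      resp : ∀ {a a′ b b′ c c′} → a ≈ a′ → b ≈ b′ → c ≈ c′ →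
             ψ ⟪ a , b ⟫ xor ψ ⟪ a ∙ b , c ⟫ ≡ ψ ⟪ a , b ∙ c ⟫ xor ψ ⟪ b , c ⟫ →
             ψ ⟪ a′ , b′ ⟫ xor ψ ⟪ a′ ∙ b′ , c′ ⟫ ≡ ψ ⟪ a′ , b′ ∙ c′ ⟫ xor ψ ⟪ b′ , c′ ⟫
      resp a≈ b≈ c≈ eq = ≡.trans
        (≡.sym (≡.cong₂ _xor_ (cong² ψ a≈ b≈) (cong² ψ (L.∙-cong a≈ b≈) c≈)))
        (≡.trans eq (≡.cong₂ _xor_ (cong² ψ a≈ (L.∙-cong b≈ c≈)) (cong² ψ b≈ c≈)))

    HasDimension-𝒞 : ∀ k → HasDimension (𝒞 L k) (n ^ k)
    HasDimension-𝒞 k = HasDimension-functionModule {R = 𝔽₂} (Pointwise.setoid L.setoid k) (Vec-finite L.setoid finite k)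

    𝒵²-finiteDimensional : FiniteDimensional (𝒵² L)
    𝒵²-finiteDimensional = submodule-finiteDimensional (𝒞 L 2) (cocycles-isSubmodule L)
      (λ {ψ} {ψ′} → IsCocycle-resp {ψ} {ψ′}) IsCocycle? (HasDimension-𝒞 2)

    HasDimension-𝒞²δ : HasDimension (𝒵² L) e → HasDimension (𝒞²δ L) (e + n)
    HasDimension-𝒞²δ 𝒵²-dim = HasDimension-≅ (𝒞²δ L) (𝒵² L ×ᴹ 𝒞 L 1) 𝒞²δ≅𝒵²×𝒞¹
      (HasDimension-×ᴹ (𝒵² L) (𝒞 L 1) 𝒵²-dim
        -- The dimension arrives as `n ^ 1`, which does not reduce to `n` for a variable `n`.
        (≡.subst (HasDimension (𝒞 L 1)) (ℕ.^-identityʳ n) (HasDimension-𝒞 1)))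

theorem11 : ∀ {c ℓ} (L : Loop c ℓ) (n : ℕ) → HasOrder L n →
    (𝒞²δ L ≅ 𝒵² L ×ᴹ 𝒞 L 1)
    × FiniteDimensional (𝒞²δ L)
    × FiniteDimensional (𝒵² L)
    × (∀ d e → HasDimension (𝒞²δ L) d → HasDimension (𝒵² L) e → d ≡ e + n)
theorem11 L n finite =
    𝒞²δ≅𝒵²×𝒞¹ L
  , (let e , 𝒵²-dim = 𝒵²-finiteDimensional L n finite in e + n , HasDimension-𝒞²δ L n finite 𝒵²-dim)
  , 𝒵²-finiteDimensional L n finite
  -- The given basis of `𝒵² L` yields a basis of `𝒞²δ L` with `e + n` elements, which is compared
  -- with the given one of `d` elements.
  , λ d e 𝒞²δ-dim 𝒵²-dim → HasDimension-unique (𝒞²δ L) 𝒞²δ-dim (HasDimension-𝒞²δ L n finite 𝒵²-dim)
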